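{- For every integer $n\ge 0$, $$\sum_{j=0}^{\infty}(-1)^{\lceil j/2\rceil}\,pod(n-T_j)=\begin{cases}1,&\text{if } n=0,\\ 0,&\text{otherwise.}\end{cases}$$
   Context: $pod(n)$ denotes the number of partitions of the nonnegative integer $n$ in which odd parts are distinct and even parts are unrestricted (may be repeated), with $pod(0)=1$ and $pod(m)=0$ for $m<0$. For $j\ge 0$, $T_j=\frac{j(j+1)}{2}$ is the $j$-th triangular number. -}

module Defs where

open import Data.Integer as ℤ using (ℤ; 0ℤ)
open import Data.List
  using (List; []; _∷_; map; concatMap; filter; length; upTo)
open import Data.List.Membership.Propositional using (_∈_; lose; find)
open import Data.List.Membership.Propositional.Properties
  using (∈-map⁺; ∈-map⁻; ∈-concatMap⁺; ∈-concatMap⁻; ∈-upTo⁺; ∈-upTo⁻; ∈-filter⁺; ∈-filter⁻)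
open import Data.List.Properties using (∷-injectiveˡ; ∷-injectiveʳ)
open import Data.List.Relation.Unary.All as All using (All; []; _∷_)
import Data.List.Relation.Unary.All.Properties as All
open import Data.List.Relation.Unary.AllPairs as AllPairs using (AllPairs; []; _∷_)
import Data.List.Relation.Unary.AllPairs.Properties as AllPairs
open import Data.List.Relation.Unary.Any using (here)
open import Data.List.Relation.Unary.Linked as Linked using (Linked; []; [-]; _∷_)
open import Data.List.Relation.Unary.Unique.Propositional using (Unique)
import Data.List.Relation.Unary.Unique.Propositional.Properties as Unique
open import Data.Nat
open import Data.Nat.ListAction using (sum)
open import Data.List.Relation.Unary.Unique.DecPropositional _≟_ using (unique?)
open import Data.Nat.Divisibility using (_∣_; _∣?_)
open import Data.Nat.DivMod using (_/_)
open import Data.Nat.Properties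
open import Data.Product using (∃-syntax; _×_; _,_; proj₁; proj₂)
open import Level using (0ℓ)
open import Relation.Binary.PropositionalEquality
  using (_≡_; _≢_; refl; sym; trans; cong)
open import Relation.Nullary using (¬_; ¬?)
open import Relation.Unary using (Pred; Decidable)

record IsPartition (n : ℕ) (xs : List ℕ) : Set where
  constructor isPartition
  field
    positive      : All (0 <_) xs
    nonincreasing : Linked _≥_ xs
    sums          : sum xs ≡ n

Odd : ℕ → Set
Odd k = ¬ (2 ∣ k)

odd? : Decidable Odd
odd? k = ¬? (2 ∣? k)

OddPartsDistinct : List ℕ → Set
OddPartsDistinct xs = Unique (filter odd? xs)

oddPartsDistinct? : Decidable OddPartsDistinct
oddPartsDistinct? xs = unique? (filter odd? xs)

IsPodPartition : ℕ → List ℕ → Set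
IsPodPartition n xs = IsPartition n xs × OddPartsDistinct xs

-- The number of objects satisfying P is the length of any such enumeration.
record Enumeration {A : Set} (P : Pred A 0ℓ) : Set where
  field
    elements : List A
    unique   : Unique elements
    sound    : ∀ {x} → x ∈ elements → P x
    complete : ∀ {x} → P x → x ∈ elements

-- partitions≤ f m n lists the partitions of n into parts at most m, by
-- largest part suc k; f is recursion fuel, sufficient as soon as n ≤ f.
partitions≤ : ℕ → ℕ → ℕ → List (List ℕ)
partitions≤ _       _ zero    = [] ∷ []
partitions≤ zero    _ (suc _) = []
partitions≤ (suc f) m (suc n) =
  concatMap (λ k → map (suc k ∷_) (partitions≤ f (suc k) (n ∸ k))) (upTo (m ⊓ suc n))

partitions≤-sound : ∀ f m n {xs} → xs ∈ partitions≤ f m n →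
                    All (0 <_) xs × Linked _≥_ (m ∷ xs) × sum xs ≡ n
partitions≤-sound zero    m zero    (here refl) = [] , [-] , refl
partitions≤-sound (suc f) m zero    (here refl) = [] , [-] , refl
partitions≤-sound (suc f) m (suc n) xs∈
  with k , k∈ , xs∈′ ← find (∈-concatMap⁻ _ {xs = upTo (m ⊓ suc n)} xs∈)
  with ys , ys∈ , refl ← ∈-map⁻ _ xs∈′
  with pos , desc , s ← partitions≤-sound f (suc k) (n ∸ k) ys∈
  = z<s ∷ pos
  , ≤-trans k< (m⊓n≤m m (suc n)) ∷ desc
  , cong suc (trans (cong (k +_) s) (m+[n∸m]≡n (s≤s⁻¹ (≤-trans k< (m⊓n≤n m (suc n))))))
  where k< = ∈-upTo⁻ k∈

partitions≤-complete : ∀ f m n {xs} → n ≤ f → All (0 <_) xs → Linked _≥_ (m ∷ xs) →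
                       sum xs ≡ n → xs ∈ partitions≤ f m n
partitions≤-complete zero    m zero    {[]} _ _ _ _ = here refl
partitions≤-complete (suc f) m zero    {[]} _ _ _ _ = here refl
partitions≤-complete _ m zero {suc x ∷ xs} _ _ _ ()
partitions≤-complete f m n {zero ∷ xs} _ (() ∷ _) _ _
partitions≤-complete (suc f) m (suc n) {suc x ∷ xs} (s≤s n≤f) (_ ∷ pos) (x<m ∷ desc) s =
  ∈-concatMap⁺ _ (lose (∈-upTo⁺ (⊓-glb x<m (s≤s x≤n)))
    (∈-map⁺ _ (partitions≤-complete f (suc x) (n ∸ x)
      (≤-trans (m∸n≤m n x) n≤f) pos desc
      (trans (sym (m+n∸m≡n x (sum xs))) (cong (_∸ x) s′)))))
  where
  s′ = suc-injective s
  x≤n = ≤-trans (m≤m+n x (sum xs)) (≤-reflexive s′)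

partitions≤-unique : ∀ f m n → Unique (partitions≤ f m n)
partitions≤-unique zero    m zero    = [] ∷ []
partitions≤-unique (suc f) m zero    = [] ∷ []
partitions≤-unique zero    m (suc n) = []
partitions≤-unique (suc f) m (suc n) = Unique.concat⁺
  (All.map⁺ (All.universal
    (λ k → Unique.map⁺ ∷-injectiveʳ (partitions≤-unique f (suc k) (n ∸ k))) _))
  (AllPairs.map⁺ (AllPairs.map disjoint (Unique.upTo⁺ (m ⊓ suc n))))
  where
  disjoint : ∀ {j k} {xss yss : List (List ℕ)} → j ≢ k → ∀ {zs} →
             ¬ (zs ∈ map (suc j ∷_) xss × zs ∈ map (suc k ∷_) yss)
  disjoint j≢k (∈j , ∈k) with ∈-map⁻ _ ∈j | ∈-map⁻ _ ∈k
  ... | _ , _ , refl | _ , _ , eq = j≢k (suc-injective (∷-injectiveˡ eq))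

partitions : ∀ n → Enumeration (IsPartition n)
partitions n = record
  { elements = partitions≤ n n n
  ; unique   = partitions≤-unique n n n
  ; sound    = λ xs∈ → let pos , desc , s = partitions≤-sound n n n xs∈
                       in isPartition pos (Linked.tail desc) s
  ; complete = λ (isPartition pos desc s) →
      partitions≤-complete n n n ≤-refl pos (bound desc s) s
  }
  where
  bound : ∀ {xs} → Linked _≥_ xs → sum xs ≡ n → Linked _≥_ (n ∷ xs)
  bound {[]}     _    _    = [-]
  bound {x ∷ xs} desc refl = m≤m+n x (sum xs) ∷ desc

podPartitions : ∀ n → Enumeration (IsPodPartition n)
podPartitions n = record
  { elements = filter oddPartsDistinct? elements
  ; unique   = Unique.filter⁺ oddPartsDistinct? unique
  ; sound    = λ xs∈ → let xs∈′ , d = ∈-filter⁻ oddPartsDistinct? {xs = elements} xs∈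
                       in sound xs∈′ , d
  ; complete = λ (p , d) → ∈-filter⁺ oddPartsDistinct? (complete p) d
  }
  where open Enumeration (partitions n)

pod : ℤ → ℕ
pod (ℤ.+ n)    = length (Enumeration.elements (podPartitions n))
pod ℤ.-[1+ _ ] = 0

T : ℕ → ℕ
T j = j * (j + 1) / 2

partialSum : (ℕ → ℤ) → ℕ → ℤ
partialSum a zero    = 0ℤ
partialSum a (suc N) = partialSum a N ℤ.+ a N

-- Convergence of the series Σ_{j≥0} a j to s: in the discrete space ℤ, the
-- partial sums converge to s exactly when they are eventually equal to s.
SumsTo : (ℕ → ℤ) → ℤ → Set
SumsTo a s = ∃[ N ] (∀ M → N ≤ M → partialSum a M ≡ s)

-- Let Qₛ = ∏_{1 ≤ i ≤ s} (1 + x²ⁱ⁻¹)/(1 − x²ⁱ), the generating function of the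
-- pod partitions with parts at most 2s.  A finite form of Gauss's theorem, due
-- to Shanks (with x replaced by −x), is
--
--   Qₙ ∑_{j < 2n} (−1)^⌈j/2⌉ x^(T j) = ∑_{s < n} (−1)ˢ Qₛ x^(s(2n+1)).
--
-- It holds by induction on n: after multiplication by 1 − x²ⁿ⁺² both sides obey
-- the same recurrence, the right-hand side because the difference telescopes.
-- In degrees at most 2n only Q₀ = 1 survives on the right, while on the left Qₙ
-- agrees there with the generating function of pod.

module Submission where

open import Defs
open import Data.Bool using (if_then_else_)
open import Data.Integer using (+_; -_; _-_; _*_; _^_; 0ℤ; 1ℤ; -1ℤ)
open import Data.Nat using (ℕ; _≡ᵇ_; ⌈_/2⌉)

open import Data.Empty using (⊥-elim)
open import Data.Integer as ℤ using (ℤ; -[1+_])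
import Data.Integer.Properties as ℤ
import Data.Integer.Tactic.RingSolver as ℤ
open import Data.List using (List; []; _∷_; _++_; map; concatMap; filter; length; upTo)
open import Data.List.Properties
open import Data.List.Relation.Unary.All as All using (All; []; _∷_)
import Data.List.Relation.Unary.All.Properties as All
open import Data.List.Relation.Unary.AllPairs as AllPairs using ([]; _∷_)
open import Data.List.Relation.Unary.Linked.Properties using (Linked⇒All)
open import Data.List.Relation.Unary.Unique.Propositional using (Unique)
open import Data.Nat as ℕ hiding (_*_; _^_; _≡ᵇ_; ⌈_/2⌉)
open import Data.Nat.Divisibility using (_∣_; divides-refl; ∣m+n∣m⇒∣n; ∣1⇒≡1)
open import Data.Nat.DivMod using (m*n/n≡m; /-congˡ; /-monoˡ-≤)
open import Data.Nat.Properties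
import Data.Nat.Tactic.RingSolver as ℕ
open import Data.Product using (_,_)
open import Data.Sum using (inj₁; inj₂)
open import Function using (_∘_; _⇔_; mk⇔; Equivalence)
open import Relation.Binary.PropositionalEquality
open import Relation.Nullary using (¬_; yes; no)

-- Counting partitions by their largest part

count : List (List ℕ) → ℕ
count = length ∘ filter oddPartsDistinct?

count-++ : ∀ xss yss → count (xss ++ yss) ≡ count xss + count yss
count-++ xss yss = trans
  (cong length (filter-++ oddPartsDistinct? xss yss))
  (length-++ (filter oddPartsDistinct? xss))

count-map : ∀ g {xss} → All (λ xs → OddPartsDistinct (g xs) ⇔ OddPartsDistinct xs) xss →
            count (map g xss) ≡ count xss
count-map g [] = refl
count-map g {xs ∷ _} (g⇔ ∷ gs⇔) with oddPartsDistinct? (g xs) | oddPartsDistinct? xs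
... | yes _ | yes _ = cong suc (count-map g gs⇔)
... | no _  | no _  = count-map g gs⇔
... | yes p | no ¬q = ⊥-elim (¬q (Equivalence.to g⇔ p))
... | no ¬p | yes q = ⊥-elim (¬p (Equivalence.from g⇔ q))

count-none : ∀ {xss} → All (¬_ ∘ OddPartsDistinct) xss → count xss ≡ 0
count-none = cong length ∘ filter-none oddPartsDistinct?

-- Every call uses one unit of fuel and lowers the sum by at least one, so sufficient fuel stays
-- sufficient. Lists can thus be normalised to the form `parts≤`.
partitions≤-fuel : ∀ {f g} m n → n ≤ f → n ≤ g → partitions≤ f m n ≡ partitions≤ g m n
partitions≤-fuel {zero}  {zero}  m zero    _ _ = refl
partitions≤-fuel {zero}  {suc _} m zero    _ _ = refl
partitions≤-fuel {suc _} {zero}  m zero    _ _ = refl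
partitions≤-fuel {suc _} {suc _} m zero    _ _ = refl
partitions≤-fuel {suc f} {suc g} m (suc n) (s≤s n≤f) (s≤s n≤g) =
  concatMap-cong
    (λ k → cong (map (suc k ∷_))
      (partitions≤-fuel (suc k) (n ∸ k) (≤-trans (m∸n≤m n k) n≤f) (≤-trans (m∸n≤m n k) n≤g)))
    (upTo (m ⊓ suc n))

parts≤ : ℕ → ℕ → List (List ℕ)
parts≤ m n = partitions≤ n m n

-- The bound enters only through its minimum with the sum, and that minimum is `n` on both sides.
parts≤-large : ∀ {l m} n → n ≤ l → n ≤ m → parts≤ l n ≡ parts≤ m n
parts≤-large zero _ _ = refl
parts≤-large (suc n) n<l n<m rewrite m≥n⇒m⊓n≡n n<l | m≥n⇒m⊓n≡n n<m = refl

-- The range of largest parts gains exactly one index, at its end; its block consists of the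
-- partitions in which `suc m` occurs.
parts≤-suc : ∀ m n → suc m ≤ n →
             parts≤ (suc m) n ≡ parts≤ m n ++ map (suc m ∷_) (parts≤ (suc m) (n ∸ suc m))
parts≤-suc m (suc n) (s≤s m≤n)
  rewrite m≤n⇒m⊓n≡m m≤n | m≤n⇒m⊓n≡m (m≤n⇒m≤1+n m≤n) = begin
  concatMap block (upTo (suc m))
    ≡⟨ cong (concatMap block) (upTo-∷ʳ m) ⟨
  concatMap block (upTo m ++ m ∷ [])
    ≡⟨ concatMap-++ block (upTo m) (m ∷ []) ⟩
  concatMap block (upTo m) ++ block m ++ []
    ≡⟨ cong (concatMap block (upTo m) ++_) (++-identityʳ (block m)) ⟩
  concatMap block (upTo m) ++ block m
    ≡⟨ cong (λ xss → concatMap block (upTo m) ++ map (suc m ∷_) xss)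
            (partitions≤-fuel (suc m) (n ∸ m) (m∸n≤m n m) ≤-refl) ⟩
  concatMap block (upTo m) ++ map (suc m ∷_) (parts≤ (suc m) (n ∸ m)) ∎
  where
  open ≡-Reasoning
  block : ℕ → List (List ℕ)
  block k = map (suc k ∷_) (partitions≤ n (suc k) (n ∸ k))

parts≤-bounded : ∀ m n → All (All (_≤ m)) (parts≤ m n)
parts≤-bounded m n = All.tabulate λ xs∈ →
  let _ , desc , _ = partitions≤-sound n m n xs∈
  in All.tail (Linked⇒All (λ j≥k k≥l → ≤-trans k≥l j≥k) ≤-refl desc)

count-map-even : ∀ {x} → 2 ∣ x → ∀ xss → count (map (x ∷_) xss) ≡ count xss
count-map-even {x} 2∣x xss = count-map (x ∷_) (All.universal (λ xs →
  let eq = filter-reject odd? {x} {xs} (λ odd → odd 2∣x)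
  in mk⇔ (subst Unique eq) (subst Unique (sym eq))) xss)

count-map-new : ∀ {m} → Odd (suc m) → ∀ n →
                count (map (suc m ∷_) (parts≤ m n)) ≡ count (parts≤ m n)
count-map-new {m} odd n = count-map (suc m ∷_) (All.map (λ {xs} xs≤m →
  let eq = filter-accept odd? {suc m} {xs} odd
      m<xs = All.filter⁺ odd? (All.map (λ x≤m → >⇒≢ (s≤s x≤m)) xs≤m)
  in mk⇔ (AllPairs.tail ∘ subst Unique eq) (λ u → subst Unique (sym eq) (m<xs ∷ u)))
  (parts≤-bounded m n))

count-map-repeated : ∀ {x} → Odd x → ∀ xss → count (map (x ∷_) (map (x ∷_) xss)) ≡ 0
count-map-repeated {x} odd xss = count-none (All.map⁺ (All.map⁺ (All.universal repeated xss)))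
  where
  repeated : ∀ xs → ¬ OddPartsDistinct (x ∷ x ∷ xs)
  repeated xs u
    with (x≢x ∷ _) ∷ _ ← subst Unique
           (trans (filter-accept odd? {x} {x ∷ xs} odd)
                  (cong (x ∷_) (filter-accept odd? {x} {xs} odd)))
           u
    = x≢x refl

-- A second copy of the odd part `suc m` violates distinctness, so only the tails with parts at most
-- `m` contribute. When `n ≤ m` no such copy fits into the tail.
count-map-odd : ∀ {m} → Odd (suc m) → ∀ n →
                count (map (suc m ∷_) (parts≤ (suc m) n)) ≡ count (parts≤ m n)
count-map-odd {m} odd n with ≤-<-connex n m
... | inj₁ n≤m = trans
  (cong (count ∘ map (suc m ∷_)) (parts≤-large n (m≤n⇒m≤1+n n≤m) n≤m))
  (count-map-new odd n)
... | inj₂ m<n = begin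
  count (map x∷_ (parts≤ (suc m) n))
    ≡⟨ cong (count ∘ map x∷_) (parts≤-suc m n m<n) ⟩
  count (map x∷_ (parts≤ m n ++ map x∷_ rest))
    ≡⟨ cong count (map-++ x∷_ (parts≤ m n) (map x∷_ rest)) ⟩
  count (map x∷_ (parts≤ m n) ++ map x∷_ (map x∷_ rest))
    ≡⟨ count-++ (map x∷_ (parts≤ m n)) (map x∷_ (map x∷_ rest)) ⟩
  count (map x∷_ (parts≤ m n)) + count (map x∷_ (map x∷_ rest))
    ≡⟨ cong₂ _+_ (count-map-new odd n) (count-map-repeated odd rest) ⟩
  count (parts≤ m n) + 0
    ≡⟨ +-identityʳ _ ⟩
  count (parts≤ m n) ∎
  where
  open ≡-Reasoning
  x∷_ = suc m ∷_
  rest = parts≤ (suc m) (n ∸ suc m)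

-- Pod partitions with bounded parts

-- For `m` equal to 2s these are the coefficients of Qₛ. Extension by zero to negative degrees lets
-- shifts be written without side conditions.
pod≤ : ℕ → ℤ → ℕ
pod≤ m (+ n)    = count (parts≤ m n)
pod≤ m -[1+ _ ] = 0

pod≤-neg : ∀ m {n k} → n < k → pod≤ m (+ n - + k) ≡ 0
pod≤-neg m {n} {k} n<k
  -- Positivity of `k ∸ n` exposes a successor, so its negation reduces to `-[1+ _ ]`.
  rewrite ℤ.m-n≡m⊖n n k | ℤ.⊖-< n<k with k ∸ n | m<n⇒0<n∸m n<k
... | suc _ | _ = refl

pod≤-large : ∀ {m n} → n ≤ m → ∀ k → pod (+ n - + k) ≡ pod≤ m (+ n - + k)
pod≤-large {m} {n} n≤m k with ≤-<-connex k n
... | inj₁ k≤n rewrite ℤ.m-n≡m⊖n n k | ℤ.⊖-≥ k≤n =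
  cong count (parts≤-large (n ∸ k) ≤-refl (≤-trans (m∸n≤m n k) n≤m))
... | inj₂ n<k rewrite ℤ.m-n≡m⊖n n k | ℤ.⊖-< n<k with k ∸ n | m<n⇒0<n∸m n<k
... | suc _ | _ = refl

-- Here `l` bounds the parts left after one `suc m` is removed: it will be `suc m` when that part is
-- even and may recur, and `m` when it is odd.
pod≤-suc : ∀ {m l} →
           (∀ n → count (map (suc m ∷_) (parts≤ (suc m) n)) ≡ count (parts≤ l n)) →
           ∀ z → pod≤ (suc m) z ≡ pod≤ m z + pod≤ l (z - + suc m)
pod≤-suc count-block -[1+ _ ] = refl
pod≤-suc {m} {l} count-block (+ n) with ≤-<-connex (suc m) n
... | inj₁ m<n rewrite ℤ.m-n≡m⊖n n (suc m) | ℤ.⊖-≥ m<n = begin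
  count (parts≤ (suc m) n)
    ≡⟨ cong count (parts≤-suc m n m<n) ⟩
  count (parts≤ m n ++ block)
    ≡⟨ count-++ (parts≤ m n) block ⟩
  count (parts≤ m n) + count block
    ≡⟨ cong (λ c → count (parts≤ m n) + c) (count-block (n ∸ suc m)) ⟩
  count (parts≤ m n) + count (parts≤ l (n ∸ suc m)) ∎
  where
  open ≡-Reasoning
  block = map (suc m ∷_) (parts≤ (suc m) (n ∸ suc m))
... | inj₂ n<1+m = begin
  count (parts≤ (suc m) n)
    ≡⟨ cong count (parts≤-large n (<⇒≤ n<1+m) (s≤s⁻¹ n<1+m)) ⟩
  count (parts≤ m n)
    ≡⟨ +-identityʳ _ ⟨
  count (parts≤ m n) + 0
    ≡⟨ cong (λ c → count (parts≤ m n) + c) (pod≤-neg l n<1+m) ⟨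
  count (parts≤ m n) + pod≤ l (+ n - + suc m) ∎
  where open ≡-Reasoning

odd-suc-double : ∀ s → Odd (suc (s ℕ.* 2))
odd-suc-double s 2∣
  with () ← ∣1⇒≡1 (∣m+n∣m⇒∣n (subst (2 ∣_) (+-comm 1 (s ℕ.* 2)) 2∣) (divides-refl s))

-- Coefficient form of (1 - x²ˢ⁺²) Qₛ₊₁ = (1 + x²ˢ⁺¹) Qₛ: the part 2s+2 is split off first, then the
-- part 2s+1.
pod≤-two-steps : ∀ s z → pod≤ (suc s ℕ.* 2) z ≡
  (pod≤ (s ℕ.* 2) z + pod≤ (s ℕ.* 2) (z - + suc (s ℕ.* 2)))
    + pod≤ (suc s ℕ.* 2) (z - + (suc s ℕ.* 2))
pod≤-two-steps s z = trans
  (pod≤-suc (λ n → count-map-even (divides-refl (suc s)) (parts≤ (suc s ℕ.* 2) n)) z)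
  (cong (_+ pod≤ (suc s ℕ.* 2) (z - + (suc s ℕ.* 2)))
    (pod≤-suc (count-map-odd (odd-suc-double s)) z))

-- Finite sums and triangular numbers

partialSum-cong : ∀ {f g} → (∀ j → f j ≡ g j) → ∀ N → partialSum f N ≡ partialSum g N
partialSum-cong f≡g zero    = refl
partialSum-cong f≡g (suc N) = cong₂ ℤ._+_ (partialSum-cong f≡g N) (f≡g N)

partialSum-+ : ∀ f g N →
  partialSum (λ j → f j ℤ.+ g j) N ≡ partialSum f N ℤ.+ partialSum g N
partialSum-+ f g zero    = refl
partialSum-+ f g (suc N) = trans
  (cong (ℤ._+ (f N ℤ.+ g N)) (partialSum-+ f g N))
  (interchange (partialSum f N) (partialSum g N) (f N) (g N))
  where
  interchange : ∀ a b c d → (a ℤ.+ b) ℤ.+ (c ℤ.+ d) ≡ (a ℤ.+ c) ℤ.+ (b ℤ.+ d)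
  interchange = ℤ.solve-∀

partialSum-stable : ∀ {f N} → (∀ {j} → N ≤ j → f j ≡ 0ℤ) →
                    ∀ {M} → N ≤ M → partialSum f M ≡ partialSum f N
partialSum-stable {f} {N} f≡0 {M} N≤M = go M (≤⇒≤′ N≤M)
  where
  go : ∀ M → N ≤′ M → partialSum f M ≡ partialSum f N
  go _ ≤′-refl = refl
  go (suc M) (≤′-step N≤M) = trans
    (cong₂ ℤ._+_ (go M N≤M) (f≡0 (≤′⇒≤ N≤M)))
    (ℤ.+-identityʳ (partialSum f N))

partialSum-zero : ∀ {f} → (∀ j → f j ≡ 0ℤ) → ∀ N → partialSum f N ≡ 0ℤ
partialSum-zero f≡0 N = partialSum-stable (λ {j} _ → f≡0 j) {N} z≤n

T-even : ∀ n → T (n ℕ.* 2) ≡ n ℕ.* suc (n ℕ.* 2)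
T-even n = trans (/-congˡ {o = 2} (product n)) (m*n/n≡m (n ℕ.* suc (n ℕ.* 2)) 2)
  where
  product : ∀ n → n ℕ.* 2 ℕ.* (n ℕ.* 2 + 1) ≡ n ℕ.* suc (n ℕ.* 2) ℕ.* 2
  product = ℕ.solve-∀

T-odd : ∀ n → T (suc (n ℕ.* 2)) ≡ suc n ℕ.* suc (n ℕ.* 2)
T-odd n = trans (/-congˡ {o = 2} (product n)) (m*n/n≡m (suc n ℕ.* suc (n ℕ.* 2)) 2)
  where
  product : ∀ n → suc (n ℕ.* 2) ℕ.* (suc (n ℕ.* 2) + 1) ≡ suc n ℕ.* suc (n ℕ.* 2) ℕ.* 2
  product = ℕ.solve-∀

j≤T : ∀ j → j ≤ T j
j≤T j = ≤-trans (≤-reflexive (sym (m*n/n≡m j 2))) (/-monoˡ-≤ 2 (product j))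
  where
  product : ∀ j → j ℕ.* 2 ≤ j ℕ.* (j + 1)
  product zero    = z≤n
  product (suc j) = *-monoʳ-≤ (suc j) (≤-trans (m≤n+m 2 j) (≤-reflexive (+-suc j 1)))

⌈n*2/2⌉≡n : ∀ n → ⌈ n ℕ.* 2 /2⌉ ≡ n
⌈n*2/2⌉≡n zero    = refl
⌈n*2/2⌉≡n (suc n) = cong suc (⌈n*2/2⌉≡n n)

⌈1+n*2/2⌉≡1+n : ∀ n → ⌈ suc (n ℕ.* 2) /2⌉ ≡ suc n
⌈1+n*2/2⌉≡1+n zero    = refl
⌈1+n*2/2⌉≡1+n (suc n) = cong suc (⌈1+n*2/2⌉≡1+n n)

-- In terms of series, (1 - xᵖ) F = 0 forces F = 0. Since `p` is positive, `suc M` shifts carry any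
-- argument beyond `M`.
periodic⇒zero : ∀ {M p} (f : ℕ → ℤ) → 0 < p → (∀ a → f a ≡ f (a + p)) →
                (∀ {a} → M < a → f a ≡ 0ℤ) → ∀ a → f a ≡ 0ℤ
periodic⇒zero {M} {p} f 0<p period support a = trans (multiple (suc M)) (support M<)
  where
  multiple : ∀ k → f a ≡ f (a + k ℕ.* p)
  multiple zero    = cong f (sym (+-identityʳ a))
  multiple (suc k) = trans (multiple k) (trans (period (a + k ℕ.* p))
    (cong f (trans (+-assoc a (k ℕ.* p) p) (cong (λ b → a + b) (+-comm (k ℕ.* p) p)))))

  M< : M < a + suc M ℕ.* p
  M< = ≤-trans (≤-trans (≤-reflexive (sym (*-identityʳ (suc M)))) (*-monoʳ-≤ (suc M) 0<p))
               (m≤n+m _ a)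

-- Shanks's identity, coefficient by coefficient

-- q s a stands for the coefficient of xᴹ in xᵃ Qₛ, so that replacing a by a + p
-- amounts to multiplying by xᵖ.
module ShanksIdentity
  (M : ℕ) (q : ℕ → ℕ → ℤ)
  (support : ∀ s {a} → M < a → q s a ≡ 0ℤ)
  (recurrence : ∀ s a → q (suc s) a ≡
     q (suc s) (a + suc s ℕ.* 2) ℤ.+ (q s a ℤ.+ q s (a + suc (s ℕ.* 2))))
  where

  thetaTerm : ℕ → ℕ → ℕ → ℤ
  thetaTerm n a j = -1ℤ ^ ⌈ j /2⌉ * q n (a + T j)

  theta : ℕ → ℕ → ℤ
  theta n a = partialSum (thetaTerm n a) (n ℕ.* 2)

  -- The identity takes `w` to be 2n+1; it stays free because the telescoping relates the sums for
  -- `w` and `2 + w`.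
  shanksTerm : ℕ → ℕ → ℕ → ℤ
  shanksTerm w a s = -1ℤ ^ s * q s (a + s ℕ.* w)

  shanks : ℕ → ℕ → ℤ
  shanks n a = partialSum (shanksTerm (suc (n ℕ.* 2)) a) n

  -- With S(w) = ∑_{s < k} (-1)ˢ Qₛ xˢʷ, this says (1 - xʷ⁺¹) S(w+2) = (1 + xʷ) S(w) + (-1)ᵏ Qₖ xᵏʷ
  -- (1 - x²ᵏ). In the induction on `k`, the recurrence for Qₖ₊₁ turns the old boundary term into
  -- the new one.
  shanks-telescope : ∀ w a k →
    partialSum (shanksTerm (2 + w) a) k ≡
      (partialSum (shanksTerm (2 + w) (a + suc w)) k ℤ.+
        (partialSum (shanksTerm w a) k ℤ.+ partialSum (shanksTerm w (a + w)) k))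
      ℤ.+ -1ℤ ^ k * (q k (a + k ℕ.* w) - q k (a + k ℕ.* w + k ℕ.* 2))
  shanks-telescope w a zero
    rewrite +-identityʳ (a + 0) | ℤ.+-inverseʳ (q 0 (a + 0)) = refl
  shanks-telescope w a (suc k) = begin
    partialSum (shanksTerm (2 + w) a) k ℤ.+ e * q k (a + k ℕ.* (2 + w))
      ≡⟨ cong₂ (λ v x → v ℤ.+ e * x) (shanks-telescope w a k) (cong (q k) (arg₁ a w k)) ⟩
    ((v ℤ.+ (r ℤ.+ r′)) ℤ.+ e * (x - z)) ℤ.+ e * z
      ≡⟨ algebra v r r′ e x y z p u ⟩
    total (u ℤ.+ (y ℤ.+ p))
      ≡⟨ cong total u-rec ⟨
    total (q (suc k) (a + suc k ℕ.* w)) ∎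
    where
    open ≡-Reasoning
    e  = -1ℤ ^ k
    v  = partialSum (shanksTerm (2 + w) (a + suc w)) k
    r  = partialSum (shanksTerm w a) k
    r′ = partialSum (shanksTerm w (a + w)) k
    x  = q k (a + k ℕ.* w)
    y  = q k (a + w + k ℕ.* w)
    z  = q k (a + k ℕ.* w + k ℕ.* 2)
    p  = q k (a + suc w + k ℕ.* (2 + w))
    u  = q (suc k) (a + suc k ℕ.* w + suc k ℕ.* 2)

    total : ℤ → ℤ
    total t = ((v ℤ.+ e * p) ℤ.+ ((r ℤ.+ e * x) ℤ.+ (r′ ℤ.+ e * y))) ℤ.+ (-1ℤ * e) * (t - u)

    arg₁ : ∀ a w k → a + k ℕ.* (2 + w) ≡ a + k ℕ.* w + k ℕ.* 2
    arg₁ = ℕ.solve-∀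
    arg₂ : ∀ a w k → a + suc k ℕ.* w ≡ a + w + k ℕ.* w
    arg₂ = ℕ.solve-∀
    arg₃ : ∀ a w k → a + suc k ℕ.* w + suc (k ℕ.* 2) ≡ a + suc w + k ℕ.* (2 + w)
    arg₃ = ℕ.solve-∀

    u-rec : q (suc k) (a + suc k ℕ.* w) ≡ u ℤ.+ (y ℤ.+ p)
    u-rec = trans (recurrence k (a + suc k ℕ.* w))
      (cong (λ t → u ℤ.+ t) (cong₂ ℤ._+_ (cong (q k) (arg₂ a w k)) (cong (q k) (arg₃ a w k))))

    algebra : ∀ v r r′ e x y z p u →
      ((v ℤ.+ (r ℤ.+ r′)) ℤ.+ e * (x - z)) ℤ.+ e * z ≡
      ((v ℤ.+ e * p) ℤ.+ ((r ℤ.+ e * x) ℤ.+ (r′ ℤ.+ e * y)))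
        ℤ.+ (-1ℤ * e) * ((u ℤ.+ (y ℤ.+ p)) - u)
    algebra = ℤ.solve-∀

  -- Both sides F of the identity satisfy
  -- (1 − x²ⁿ⁺²) Fₙ₊₁ = (1 + x²ⁿ⁺¹) Fₙ + correction n.
  correction : ℕ → ℕ → ℤ
  correction n a = -1ℤ ^ n * (q n (a + n ℕ.* suc (n ℕ.* 2))
                    - q n (a + suc (n ℕ.* 2) + suc n ℕ.* suc (n ℕ.* 2)))

  -- The telescoped sums include s = n, which `shanks n` omits. These extra terms and the boundary
  -- term, reduced to Qₙ by the recurrence, leave `correction n a`.
  shanks-step : ∀ n a → shanks (suc n) a ≡
    shanks (suc n) (a + suc n ℕ.* 2)
      ℤ.+ ((shanks n a ℤ.+ shanks n (a + suc (n ℕ.* 2))) ℤ.+ correction n a)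
  shanks-step n a = begin
    shanks (suc n) a
      ≡⟨ shanks-telescope w a (suc n) ⟩
    total (q (suc n) (a + suc n ℕ.* w))
      ≡⟨ cong total (recurrence n (a + suc n ℕ.* w)) ⟩
    total (u ℤ.+ (q n (a + suc n ℕ.* w) ℤ.+ q n (a + suc n ℕ.* w + w)))
      ≡⟨ cong₂ (λ s t → total (u ℤ.+ (s ℤ.+ t))) (cong (q n) (arg₁ a w n)) (cong (q n) (arg₂ a w n)) ⟩
    total (u ℤ.+ (y ℤ.+ z))
      ≡⟨ algebra v r r′ e x y z u ⟩
    v ℤ.+ ((r ℤ.+ r′) ℤ.+ e * (x - z)) ∎
    where
    open ≡-Reasoning
    w  = suc (n ℕ.* 2)
    e  = -1ℤ ^ n
    v  = shanks (suc n) (a + suc w)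
    r  = shanks n a
    r′ = shanks n (a + w)
    x  = q n (a + n ℕ.* w)
    y  = q n (a + w + n ℕ.* w)
    z  = q n (a + w + suc n ℕ.* w)
    u  = q (suc n) (a + suc n ℕ.* w + suc n ℕ.* 2)

    total : ℤ → ℤ
    total t = (v ℤ.+ ((r ℤ.+ e * x) ℤ.+ (r′ ℤ.+ e * y))) ℤ.+ (-1ℤ * e) * (t - u)

    arg₁ : ∀ a w k → a + suc k ℕ.* w ≡ a + w + k ℕ.* w
    arg₁ = ℕ.solve-∀
    arg₂ : ∀ a w k → a + suc k ℕ.* w + w ≡ a + w + suc k ℕ.* w
    arg₂ = ℕ.solve-∀

    algebra : ∀ v r r′ e x y z u →
      (v ℤ.+ ((r ℤ.+ e * x) ℤ.+ (r′ ℤ.+ e * y))) ℤ.+ (-1ℤ * e) * ((u ℤ.+ (y ℤ.+ z)) - u) ≡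
      v ℤ.+ ((r ℤ.+ r′) ℤ.+ e * (x - z))
    algebra = ℤ.solve-∀

  thetaTerm-step : ∀ n a j → thetaTerm (suc n) a j ≡
    thetaTerm (suc n) (a + suc n ℕ.* 2) j
      ℤ.+ (thetaTerm n a j ℤ.+ thetaTerm n (a + suc (n ℕ.* 2)) j)
  thetaTerm-step n a j = begin
    e * q (suc n) (a + T j)
      ≡⟨ cong (e *_) (recurrence n (a + T j)) ⟩
    e * (q (suc n) (a + T j + suc n ℕ.* 2) ℤ.+ (q n (a + T j) ℤ.+ q n (a + T j + w)))
      ≡⟨ cong₂ (λ s t → e * (q (suc n) s ℤ.+ (q n (a + T j) ℤ.+ q n t)))
               (swap a (T j) (suc n ℕ.* 2)) (swap a (T j) w) ⟩
    e * (q (suc n) (a + suc n ℕ.* 2 + T j) ℤ.+ (q n (a + T j) ℤ.+ q n (a + w + T j)))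
      ≡⟨ distrib e (q (suc n) (a + suc n ℕ.* 2 + T j)) (q n (a + T j)) (q n (a + w + T j)) ⟩
    thetaTerm (suc n) (a + suc n ℕ.* 2) j ℤ.+ (thetaTerm n a j ℤ.+ thetaTerm n (a + w) j) ∎
    where
    open ≡-Reasoning
    e = -1ℤ ^ ⌈ j /2⌉
    w = suc (n ℕ.* 2)
    swap : ∀ a b c → a + b + c ≡ a + c + b
    swap = ℕ.solve-∀
    distrib : ∀ e x y z → e * (x ℤ.+ (y ℤ.+ z)) ≡ e * x ℤ.+ (e * y ℤ.+ e * z)
    distrib = ℤ.solve-∀

  thetaTerm-even : ∀ n a → thetaTerm n a (n ℕ.* 2) ≡ -1ℤ ^ n * q n (a + n ℕ.* suc (n ℕ.* 2))
  thetaTerm-even n a = cong₂ (λ s t → -1ℤ ^ s * q n (a + t)) (⌈n*2/2⌉≡n n) (T-even n)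

  thetaTerm-odd : ∀ n a →
    thetaTerm n a (suc (n ℕ.* 2)) ≡ -1ℤ ^ suc n * q n (a + suc n ℕ.* suc (n ℕ.* 2))
  thetaTerm-odd n a = cong₂ (λ s t → -1ℤ ^ s * q n (a + t)) (⌈1+n*2/2⌉≡1+n n) (T-odd n)

  theta-extend : ∀ n a → partialSum (thetaTerm n a) (suc n ℕ.* 2) ≡
    (theta n a ℤ.+ -1ℤ ^ n * q n (a + n ℕ.* suc (n ℕ.* 2)))
      ℤ.+ -1ℤ ^ suc n * q n (a + suc n ℕ.* suc (n ℕ.* 2))
  theta-extend n a =
    cong₂ (λ s t → (theta n a ℤ.+ s) ℤ.+ t) (thetaTerm-even n a) (thetaTerm-odd n a)

  -- The recurrence applies termwise; `correction n a` comes from the two indices 2n and 2n+1 that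
  -- `theta n` omits.
  theta-step : ∀ n a → theta (suc n) a ≡
    theta (suc n) (a + suc n ℕ.* 2)
      ℤ.+ ((theta n a ℤ.+ theta n (a + suc (n ℕ.* 2))) ℤ.+ correction n a)
  theta-step n a = begin
    theta (suc n) a
      ≡⟨ partialSum-cong (thetaTerm-step n a) N ⟩
    partialSum (λ j → thetaTerm (suc n) (a + N) j ℤ.+ (thetaTerm n a j ℤ.+ thetaTerm n (a + w) j)) N
      ≡⟨ partialSum-+ (thetaTerm (suc n) (a + N)) _ N ⟩
    v ℤ.+ partialSum (λ j → thetaTerm n a j ℤ.+ thetaTerm n (a + w) j) N
      ≡⟨ cong (λ t → v ℤ.+ t) (partialSum-+ (thetaTerm n a) _ N) ⟩
    v ℤ.+ (partialSum (thetaTerm n a) N ℤ.+ partialSum (thetaTerm n (a + w)) N)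
      ≡⟨ cong₂ (λ s t → v ℤ.+ (s ℤ.+ t)) (theta-extend n a) (theta-extend n (a + w)) ⟩
    v ℤ.+ (((r ℤ.+ e * x) ℤ.+ -1ℤ * e * q n (a + suc n ℕ.* w))
      ℤ.+ ((r′ ℤ.+ e * q n (a + w + n ℕ.* w)) ℤ.+ -1ℤ * e * z))
      -- Since T(2n+1) = (2n+1) + T(2n), the unshifted term of index 2n+1 cancels the shifted term
      -- of index 2n.
      ≡⟨ cong (λ b → v ℤ.+ (((r ℤ.+ e * x) ℤ.+ -1ℤ * e * q n b)
                   ℤ.+ ((r′ ℤ.+ e * y) ℤ.+ -1ℤ * e * z)))
              (arg a w n) ⟩
    v ℤ.+ (((r ℤ.+ e * x) ℤ.+ -1ℤ * e * y) ℤ.+ ((r′ ℤ.+ e * y) ℤ.+ -1ℤ * e * z))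
      ≡⟨ algebra v r r′ e x y z ⟩
    v ℤ.+ ((r ℤ.+ r′) ℤ.+ e * (x - z)) ∎
    where
    open ≡-Reasoning
    N  = suc n ℕ.* 2
    w  = suc (n ℕ.* 2)
    e  = -1ℤ ^ n
    v  = theta (suc n) (a + N)
    r  = theta n a
    r′ = theta n (a + w)
    x  = q n (a + n ℕ.* w)
    y  = q n (a + w + n ℕ.* w)
    z  = q n (a + w + suc n ℕ.* w)

    arg : ∀ a w k → a + suc k ℕ.* w ≡ a + w + k ℕ.* w
    arg = ℕ.solve-∀

    algebra : ∀ v r r′ e x y z →
      v ℤ.+ (((r ℤ.+ e * x) ℤ.+ -1ℤ * e * y) ℤ.+ ((r′ ℤ.+ e * y) ℤ.+ -1ℤ * e * z)) ≡
      v ℤ.+ ((r ℤ.+ r′) ℤ.+ e * (x - z))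
    algebra = ℤ.solve-∀

  -- By induction the common recurrence makes the difference of the two sides periodic in `a` with
  -- period 2n+2. It vanishes for `a` beyond `M`, hence everywhere.
  theta≡shanks : ∀ n a → theta n a ≡ shanks n a
  theta≡shanks zero    a = refl
  theta≡shanks (suc n) a =
    ℤ.i-j≡0⇒i≡j _ _
      (periodic⇒zero (λ b → theta (suc n) b - shanks (suc n) b) z<s period difference-support a)
    where
    cancel : ∀ s t c → (s ℤ.+ c) - (t ℤ.+ c) ≡ s - t
    cancel = ℤ.solve-∀

    period : ∀ b → theta (suc n) b - shanks (suc n) b ≡
                   theta (suc n) (b + suc n ℕ.* 2) - shanks (suc n) (b + suc n ℕ.* 2)
    period b
      rewrite theta-step n b | shanks-step n b
            | theta≡shanks n b | theta≡shanks n (b + suc (n ℕ.* 2))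
      = cancel (theta (suc n) (b + suc n ℕ.* 2)) (shanks (suc n) (b + suc n ℕ.* 2)) _

    term-zero : ∀ e s {b} c → M < b → e * q s (b + c) ≡ 0ℤ
    term-zero e s {b} c M<b =
      trans (cong (e *_) (support s (≤-trans M<b (m≤m+n b c)))) (ℤ.*-zeroʳ e)

    difference-support : ∀ {b} → M < b → theta (suc n) b - shanks (suc n) b ≡ 0ℤ
    difference-support M<b = cong₂ _-_
      (partialSum-zero (λ j → term-zero (-1ℤ ^ ⌈ j /2⌉) (suc n) (T j) M<b) (suc n ℕ.* 2))
      (partialSum-zero (λ s → term-zero (-1ℤ ^ s) s (s ℕ.* suc (suc n ℕ.* 2)) M<b) (suc n))

-- From the finite identity to the series

theorem3p1 : ∀ (n : ℕ) →
    SumsTo (λ j → (-1ℤ ^ ⌈ j /2⌉) * (+ pod (+ n - + T j)))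
    (if n ≡ᵇ 0 then 1ℤ else 0ℤ)
-- The choice `h = suc n` gives n < 2h. Hence terms of index at least 2h vanish because `j ≤ T j`,
-- and the bound 2h on the parts excludes nothing in degrees up to `n`.
theorem3p1 n = h ℕ.* 2 , λ K h*2≤K → begin
  partialSum term K
    ≡⟨ partialSum-stable
         (λ {j} h*2≤j → term-vanishes {j} (≤-trans n<h*2 (≤-trans h*2≤j (j≤T j)))) h*2≤K ⟩
  partialSum term (h ℕ.* 2)
    ≡⟨ partialSum-cong
         (λ j → cong (λ p → -1ℤ ^ ⌈ j /2⌉ * + p) (pod≤-large (<⇒≤ n<h*2) (T j))) (h ℕ.* 2) ⟩
  theta h 0
    ≡⟨ theta≡shanks h 0 ⟩
  shanks h 0
    -- For s ≥ 1 the exponent s(2h+1) exceeds `n`, so only the term of Q₀ = 1 survives.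
    ≡⟨ partialSum-stable later-vanish {h} (s≤s z≤n) ⟩
  0ℤ ℤ.+ 1ℤ * + pod≤ 0 (+ n - 0ℤ)
    ≡⟨ constant n ⟩
  (if n ≡ᵇ 0 then 1ℤ else 0ℤ) ∎
  where
  open ≡-Reasoning
  h = suc n
  term : ℕ → ℤ
  term j = (-1ℤ ^ ⌈ j /2⌉) * (+ pod (+ n - + T j))

  n<h*2 : n < h ℕ.* 2
  n<h*2 = m≤m*n h 2

  -- The degree `M` of the identity is taken to be `n`; multiplication by xᵃ lowers the degree read
  -- off from Qₛ to n - a.
  q : ℕ → ℕ → ℤ
  q s a = + pod≤ (s ℕ.* 2) (+ n - + a)

  support : ∀ s {a} → n < a → q s a ≡ 0ℤ
  support s n<a = cong (λ p → + p) (pod≤-neg (s ℕ.* 2) n<a)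

  shift : ∀ a b → (+ n - + a) - + b ≡ + n - + (a + b)
  shift a b = trans (assoc (+ n) (+ a) (+ b)) (cong (λ i → + n - i) (sym (ℤ.pos-+ a b)))
    where
    assoc : ∀ i j k → (i - j) - k ≡ i - (j ℤ.+ k)
    assoc = ℤ.solve-∀

  recurrence : ∀ s a → q (suc s) a ≡
    q (suc s) (a + suc s ℕ.* 2) ℤ.+ (q s a ℤ.+ q s (a + suc (s ℕ.* 2)))
  recurrence s a
    rewrite sym (shift a (suc s ℕ.* 2)) | sym (shift a (suc (s ℕ.* 2)))
          | pod≤-two-steps s (+ n - + a)
    = ℤ.+-comm
        (+ (pod≤ (s ℕ.* 2) (+ n - + a) + pod≤ (s ℕ.* 2) ((+ n - + a) - + suc (s ℕ.* 2))))
        (+ pod≤ (suc s ℕ.* 2) ((+ n - + a) - + (suc s ℕ.* 2)))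

  open ShanksIdentity n q support recurrence

  term-vanishes : ∀ {j} → n < T j → term j ≡ 0ℤ
  term-vanishes {j} n<T = trans
    (cong (λ p → -1ℤ ^ ⌈ j /2⌉ * + p)
      (trans (pod≤-large (≤-refl {n}) (T j)) (pod≤-neg n n<T)))
    (ℤ.*-zeroʳ (-1ℤ ^ ⌈ j /2⌉))

  later-vanish : ∀ {s} → 1 ≤ s → -1ℤ ^ s * q s (s ℕ.* suc (h ℕ.* 2)) ≡ 0ℤ
  later-vanish {s@(suc t)} _ = trans
    (cong (-1ℤ ^ s *_) (support s (≤-trans n<h*2 (≤-trans (n≤1+n _) (m≤m+n (suc (h ℕ.* 2)) _)))))
    (ℤ.*-zeroʳ (-1ℤ ^ s))

  constant : ∀ n → 0ℤ ℤ.+ 1ℤ * + pod≤ 0 (+ n - 0ℤ) ≡ (if n ≡ᵇ 0 then 1ℤ else 0ℤ)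
  constant zero    = refl
  constant (suc n) = refl
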